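{- Let $r>0$ be an integer. For all integers $m>n\ge 0$, the number $t_n(m;r)$ of ballot paths to $(n,m)$ avoiding $r$ consecutive $\uparrow$ steps equals $$t_{n}(m;r)=\sum_{i=0}^{m-n-1}\frac{1}{m+1-i}\binom{i-m+n}{i}_{r}\binom{m+1-i}{m-i}_{r}.$$ Furthermore, $t_{n}(n;r)=t_{n-1}(n;r)=\dfrac{1}{n+1}\dbinom{n+1}{n}_{r}$ for all integers $n>0$.
   Context: For integers $n,m\ge 0$ with $m\ge n$, $t_n(m;r)$ is the number of lattice paths from $(0,0)$ to $(n,m)$ with unit steps $\uparrow=(0,1)$ and $\rightarrow=(1,0)$ that stay weakly above the line $y=x$ and contain no $r$ consecutive $\uparrow$ steps. Euler coefficient: for any real $x$ and integer $n\ge 0$, $\binom{x}{n}_r=[t^n](1+t+\cdots+t^{r-1})^x$ (coefficient of $t^n$ in the formal power series), equivalently $\binom{x}{n}_r=\sum_{i=0}^{\lfloor n/r\rfloor}(-1)^i\binom{x}{i}\binom{x+n-ri-1}{n-ri}$, where ordinary binomial coefficients are polynomials in the upper argument (so negative upper arguments are allowed). -}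

module Defs where

open import Data.Integer.Base as ℤ using (ℤ; +_)
open import Data.List.Base using (List; []; _∷_; filter; length; inits; replicate; cartesianProductWith)
open import Data.List.Relation.Binary.Infix.Heterogeneous using (Infix)
open import Data.List.Relation.Binary.Infix.Heterogeneous.Properties using (infix?)
open import Data.List.Relation.Unary.All using (All; all?)
open import Data.Nat.Base as ℕ using (ℕ; zero; suc; _∸_)
import Data.Nat.Properties as ℕ
open import Data.Product.Base using (_×_)
open import Data.Rational.Base using (ℚ; 0ℚ; 1ℚ; _+_; _-_; _*_; _/_)
open import Relation.Binary.Definitions using (DecidableEquality)
open import Relation.Binary.PropositionalEquality.Core using (_≡_; refl)
open import Relation.Nullary.Decidable using (Dec; yes; no; _×-dec_; ¬?)
open import Relation.Nullary.Negation.Core using (¬_)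

------------------------------------------------------------------------
-- Lattice paths

data Step : Set where
  north east : Step

_≟_ : DecidableEquality Step
north ≟ north = yes refl
north ≟ east  = no λ ()
east  ≟ north = no λ ()
east  ≟ east  = yes refl

-- A path starts at (0,0) and is given by its list of steps.
Path : Set
Path = List Step

xEnd yEnd : Path → ℕ
xEnd p = length (filter (_≟ east) p)
yEnd p = length (filter (_≟ north) p)

WeaklyAboveDiagonal : Path → Set
WeaklyAboveDiagonal p = All (λ q → xEnd q ℕ.≤ yEnd q) (inits p)

-- Infix is the contiguous-sublist relation.
Avoids : ℕ → Path → Set
Avoids r p = ¬ Infix _≡_ (replicate r north) p

BallotPath : (n m r : ℕ) → Path → Set
BallotPath n m r p =
  (xEnd p ≡ n × yEnd p ≡ m) × WeaklyAboveDiagonal p × Avoids r p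

ballotPath? : ∀ n m r p → Dec (BallotPath n m r p)
ballotPath? n m r p =
  ((xEnd p ℕ.≟ n) ×-dec (yEnd p ℕ.≟ m))
  ×-dec all? (λ q → xEnd q ℕ.≤? yEnd q) (inits p)
  ×-dec ¬? (infix? _≟_ (replicate r north) p)

pathsOfLength : ℕ → List Path
pathsOfLength zero    = [] ∷ []
pathsOfLength (suc k) =
  cartesianProductWith _∷_ (north ∷ east ∷ []) (pathsOfLength k)

t : (n m r : ℕ) → ℕ
t n m r = length (filter (ballotPath? n m r) (pathsOfLength (n ℕ.+ m)))

------------------------------------------------------------------------
-- Finite sums and embeddings into ℚ

sumBelow : ℕ → (ℕ → ℚ) → ℚ
sumBelow zero    f = 0ℚ
sumBelow (suc n) f = sumBelow n f + f n

syntax sumBelow n (λ i → e) = Σ[ i < n ] e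

fromℤ : ℤ → ℚ
fromℤ z = z / 1

fromℕ : ℕ → ℚ
fromℕ n = fromℤ (+ n)

------------------------------------------------------------------------
-- Formal power series over ℚ, as coefficient sequences

Series : Set
Series = ℕ → ℚ

1ˢ : Series
1ˢ zero    = 1ℚ
1ˢ (suc _) = 0ℚ

_-ˢ_ : Series → Series → Series
(f -ˢ g) n = f n - g n

_*ˢ_ : Series → Series → Series
(f *ˢ g) n = Σ[ i < suc n ] (f i * g (n ∸ i))

_^ˢ_ : Series → ℕ → Series
f ^ˢ zero  = 1ˢ
f ^ˢ suc k = f *ˢ (f ^ˢ k)

-- x (x - 1) ⋯ (x - k + 1) / k !
binomial : ℚ → ℕ → ℚ
binomial x zero    = 1ℚ
binomial x (suc k) = binomial x k * (x - fromℕ k) * (+ 1 / suc k)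

-- f ^ x = Σₖ binomial x k · (f - 1) ^ k for a series f with constant
-- term 1.  As f - 1 then has no constant term, (f - 1) ^ k contributes
-- to the coefficient of tⁿ only when k ≤ n.
power : Series → ℚ → Series
power f x n = Σ[ k < suc n ] (binomial x k * ((f -ˢ 1ˢ) ^ˢ k) n)

------------------------------------------------------------------------
-- Euler coefficients

-- 1 + t + ⋯ + t ^ (r - 1); its constant term is 1 when r > 0.
truncatedGeometric : ℕ → Series
truncatedGeometric zero    _       = 0ℚ
truncatedGeometric (suc r) zero    = 1ℚ
truncatedGeometric (suc r) (suc j) = truncatedGeometric r j

-- The coefficient of tⁿ in (1 + t + ⋯ + t ^ (r - 1)) ^ x, with x rational
-- rather than real; only integer values of x are used.
euler : (r : ℕ) → ℚ → ℕ → ℚ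
euler r x n = power (truncatedGeometric r) x n

{-# OPTIONS --safe #-}
module Submission where

-- Write F = 1 + t + ⋯ + t ^ (r - 1), let T n be the generating function, by
-- the height m, of the ballot paths to (n , m) without r consecutive north
-- steps (the series Tˢ r n), and let C k be the number of those to (k , k).
--
-- Such a path to x = n + 1 is one to x = n that ends strictly above the diagonal,
-- followed by an east step and a run of fewer than r north steps.  Hence
-- T (n + 1) = F (T n - C n t ^ n) and T 0 = F, that is
--
--   T n = F ^ (n + 1) - Σ (k < n) C k t ^ k F ^ (n - k)      (T-formula).
--
-- No ballot path ends below the diagonal, so T n = 0 modulo t ^ n.  Therefore
--
--   F ^ (x + 1) = Σ (k < M) C k t ^ k F ^ (x - k)   modulo t ^ M
--
-- for x = M.  Replacing x by x + 1 multiplies both sides by F, which is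
-- invertible, so the congruence holds for all integers x ≤ M (excess-full is
-- the case 0 ≤ x).  This needs only F ^ (x + 1) = F F ^ x for the binomial
-- series, which is Pascal's rule (power-suc).
--
-- Taking x = n and M = m + 1 with n < m, the coefficient of t ^ m in T n is what
-- remains of the congruence, the sum of C k [t ^ (m - k)] F ^ (n - k) over
-- n < k ≤ m (T-offDiagonal).
--
-- It remains to see that (m + 1) C m = [t ^ m] F ^ (m + 1) for m > 0 (C-formula),
-- which is Lagrange inversion in disguise.  With θ = t d/dt, multiply the congruence for
-- x = m - 1 by θ F.  The coefficient of t ^ m on the left is
-- [t ^ m] F ^ m θ F = m / (m + 1) [t ^ m] F ^ (m + 1); on the right,
-- [t ^ p] F ^ (p - 1) θ F = [t ^ p] F ^ p for p = m - k > 0 turns the sum into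
-- the congruence for x = m without its last term C m.
--
-- This also gives the value on the diagonal n = m > 0, where the last step must
-- be an east step, so that the paths to (n , n) and to (n - 1 , n) correspond
-- (T-diagonal).

open import Data.Bool.Base using (true; false)
open import Data.Integer.Base as ℤ using (+_)
import Data.Integer.Properties as ℤ
open import Data.List.Base using (List; []; _∷_; _∷ʳ_; _++_; [_]; map; filter; length; inits; tails; replicate; reverse)
open import Data.List.Properties using (filter-≐; filter-none; filter-++; filter-accept; length-++; ++-identityʳ; ++-assoc; map-++; unfold-reverse; reverse-++; reverse-involutive)
open import Data.List.Relation.Binary.Infix.Heterogeneous using (Infix; here; there; MkView; toView; fromView)
open import Data.List.Relation.Binary.Infix.Heterogeneous.Properties using (infix?)
open import Data.List.Relation.Binary.Pointwise using (Pointwise-≡⇒≡; ≡⇒Pointwise-≡)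
open import Data.List.Relation.Binary.Prefix.Heterogeneous using (Prefix; []; _∷_)
open import Data.List.Relation.Binary.Prefix.Heterogeneous.Properties using (prefix?)
open import Data.List.Relation.Unary.All as All using (All; []; _∷_; all?)
import Data.List.Relation.Unary.All.Properties as All
open import Data.Nat.Base as ℕ using (ℕ; zero; suc; _∸_; z≤n; s≤s)
import Data.Nat.Properties as ℕ
open import Data.Product.Base using (_×_; _,_)
open import Data.Rational.Base using (ℚ; 0ℚ; 1ℚ; _+_; _-_; _*_; -_; _/_; toℚᵘ)
import Data.Rational.Properties as ℚ
open import Data.Rational.Solver using (module +-*-Solver)
open import Data.Rational.Unnormalised.Base as ℚᵘ using (mkℚᵘ; *≡*)
import Data.Rational.Unnormalised.Properties as ℚᵘ
open import Data.Sum.Base using (inj₁; inj₂)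
open import Function.Base using (_∘_)
open import Level using (0ℓ)
open import Relation.Binary.PropositionalEquality hiding ([_])
open import Relation.Nullary.Decidable using (does; _×-dec_; ¬?)
open import Relation.Nullary.Negation.Core using (¬_)
open import Relation.Unary using (Pred; Decidable)
open import Defs

open +-*-Solver using (solve; _:=_; _:+_; _:*_; _:-_; :-_; con)
open ≡-Reasoning

-- The embedding of the integers into the rationals

fromℤ-+ : ∀ a b → fromℤ (a ℤ.+ b) ≡ fromℤ a + fromℤ b
fromℤ-+ a b = ℚ.toℚᵘ-injective (R.begin
  toℚᵘ (fromℤ (a ℤ.+ b))              R.≈⟨ ℚ.toℚᵘ-fromℚᵘ (mkℚᵘ (a ℤ.+ b) 0) ⟩
  mkℚᵘ (a ℤ.+ b) 0                    R.≈⟨ *≡* (cong (ℤ._* + 1) (cong₂ ℤ._+_ (sym (ℤ.*-identityʳ a)) (sym (ℤ.*-identityʳ b)))) ⟩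
  mkℚᵘ a 0 ℚᵘ.+ mkℚᵘ b 0              R.≈⟨ ℚᵘ.+-cong (ℚ.toℚᵘ-fromℚᵘ (mkℚᵘ a 0)) (ℚ.toℚᵘ-fromℚᵘ (mkℚᵘ b 0)) ⟨
  toℚᵘ (fromℤ a) ℚᵘ.+ toℚᵘ (fromℤ b)  R.≈⟨ ℚ.toℚᵘ-homo-+ (fromℤ a) (fromℤ b) ⟨
  toℚᵘ (fromℤ a + fromℤ b)            R.∎)
  where
  import Relation.Binary.Reasoning.Setoid ℚᵘ.≃-setoid as R

fromℕ-suc : ∀ n → fromℕ (suc n) ≡ fromℕ n + 1ℚ
fromℕ-suc n = trans (cong fromℕ (ℕ.+-comm 1 n)) (fromℤ-+ (+ n) (+ 1))

fromℤ-neg : ∀ a → fromℤ (ℤ.- a) ≡ - fromℤ a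
fromℤ-neg a = begin
  fromℤ (ℤ.- a)                           ≡⟨ solve 2 (λ x y → x := (x :+ y) :- y) refl (fromℤ (ℤ.- a)) (fromℤ a) ⟩
  (fromℤ (ℤ.- a) + fromℤ a) - fromℤ a     ≡⟨ cong (_- fromℤ a) (fromℤ-+ (ℤ.- a) a) ⟨
  fromℤ (ℤ.- a ℤ.+ a) - fromℤ a           ≡⟨ cong (λ z → fromℤ z - fromℤ a) (ℤ.+-inverseˡ a) ⟩
  0ℚ - fromℤ a                            ≡⟨ ℚ.+-identityˡ _ ⟩
  - fromℤ a                               ∎

fromℕ-∸ : ∀ {k n} → k ℕ.≤ n → fromℕ (n ∸ k) ≡ fromℕ n - fromℕ k
fromℕ-∸ {k} {n} k≤n = begin
  fromℕ (n ∸ k)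
    ≡⟨ solve 2 (λ x y → x := (y :+ x) :- y) refl (fromℕ (n ∸ k)) (fromℕ k) ⟩
  fromℕ k + fromℕ (n ∸ k) - fromℕ k
    ≡⟨ cong (_- fromℕ k) (fromℤ-+ (+ k) (+ (n ∸ k))) ⟨
  fromℕ (k ℕ.+ (n ∸ k)) - fromℕ k
    ≡⟨ cong (λ z → fromℕ z - fromℕ k) (ℕ.m+[n∸m]≡n k≤n) ⟩
  fromℕ n - fromℕ k ∎

suc*recip : ∀ n → fromℕ (suc n) * (+ 1 / suc n) ≡ 1ℚ
suc*recip n = ℚ.toℚᵘ-injective (R.begin
  toℚᵘ (fromℕ (suc n) * (+ 1 / suc n))
    R.≈⟨ ℚ.toℚᵘ-homo-* (fromℕ (suc n)) (+ 1 / suc n) ⟩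
  toℚᵘ (fromℕ (suc n)) ℚᵘ.* toℚᵘ (+ 1 / suc n)
    R.≈⟨ ℚᵘ.*-cong (ℚ.toℚᵘ-fromℚᵘ (mkℚᵘ (+ suc n) 0)) (ℚ.toℚᵘ-fromℚᵘ (mkℚᵘ (+ 1) n)) ⟩
  mkℚᵘ (+ suc n) 0 ℚᵘ.* mkℚᵘ (+ 1) n
    R.≈⟨ *≡* (trans (ℤ.*-identityʳ _) (trans (ℤ.*-identityʳ _)
           (trans (cong (+_ ∘ suc) (sym (ℕ.+-identityʳ n))) (sym (ℤ.*-identityˡ _))))) ⟩
  mkℚᵘ (+ 1) 0
    R.∎)
  where
  import Relation.Binary.Reasoning.Setoid ℚᵘ.≃-setoid as R

suc-cancelˡ : ∀ n {x y} → fromℕ (suc n) * x ≡ fromℕ (suc n) * y → x ≡ y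
suc-cancelˡ n {x} {y} eq = trans (undo x) (trans (cong ((+ 1 / suc n) *_) eq) (sym (undo y)))
  where
  undo : ∀ z → z ≡ (+ 1 / suc n) * (fromℕ (suc n) * z)
  undo z = begin
    z                                      ≡⟨ ℚ.*-identityˡ z ⟨
    1ℚ * z                                 ≡⟨ cong (_* z) (suc*recip n) ⟨
    fromℕ (suc n) * (+ 1 / suc n) * z      ≡⟨ solve 3 (λ a b c → a :* b :* c := b :* (a :* c)) refl (fromℕ (suc n)) (+ 1 / suc n) z ⟩
    (+ 1 / suc n) * (fromℕ (suc n) * z)    ∎

-- Finite sums

-- Only the indices in range matter.
sum-cong : ∀ K {f g : ℕ → ℚ} → (∀ i → i ℕ.< K → f i ≡ g i) → sumBelow K f ≡ sumBelow K g
sum-cong zero    eq = refl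
sum-cong (suc K) eq =
  cong₂ _+_ (sum-cong K (λ i i<K → eq i (ℕ.m<n⇒m<1+n i<K))) (eq K ℕ.≤-refl)

sum-zero : ∀ K {f : ℕ → ℚ} → (∀ i → i ℕ.< K → f i ≡ 0ℚ) → sumBelow K f ≡ 0ℚ
sum-zero zero    eq = refl
sum-zero (suc K) eq =
  cong₂ _+_ (sum-zero K (λ i i<K → eq i (ℕ.m<n⇒m<1+n i<K))) (eq K ℕ.≤-refl)

sum-+ : ∀ K (f g : ℕ → ℚ) → sumBelow K (λ i → f i + g i) ≡ sumBelow K f + sumBelow K g
sum-+ zero    f g = refl
sum-+ (suc K) f g = trans (cong (_+ (f K + g K)) (sum-+ K f g))
  (solve 4 (λ a b c d → (a :+ b) :+ (c :+ d) := (a :+ c) :+ (b :+ d)) refl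
    (sumBelow K f) (sumBelow K g) (f K) (g K))

sum-*ˡ : ∀ K c (f : ℕ → ℚ) → sumBelow K (λ i → c * f i) ≡ c * sumBelow K f
sum-*ˡ zero    c f = sym (ℚ.*-zeroʳ c)
sum-*ˡ (suc K) c f = trans (cong (_+ c * f K) (sum-*ˡ K c f)) (sym (ℚ.*-distribˡ-+ c _ _))

sum-front : ∀ K (f : ℕ → ℚ) → sumBelow (suc K) f ≡ f 0 + sumBelow K (f ∘ suc)
sum-front zero    f = ℚ.+-comm 0ℚ (f 0)
sum-front (suc K) f = trans (cong (_+ f (suc K)) (sum-front K f)) (ℚ.+-assoc (f 0) _ _)

sum-extend : ∀ K d {f : ℕ → ℚ} → (∀ i → K ℕ.≤ i → f i ≡ 0ℚ) → sumBelow (d ℕ.+ K) f ≡ sumBelow K f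
sum-extend K zero    eq = refl
sum-extend K (suc d) eq =
  trans (cong₂ _+_ (sum-extend K d eq) (eq (d ℕ.+ K) (ℕ.m≤n+m K d))) (ℚ.+-identityʳ _)

-- Splits off the terms with index at least n, in decreasing order of the index.
sum-split : ∀ n a (f : ℕ → ℚ) →
  sumBelow (a ℕ.+ n) f ≡ sumBelow n f + Σ[ i < a ] f (a ℕ.+ n ∸ suc i)
sum-split n zero    f = sym (ℚ.+-identityʳ _)
sum-split n (suc a) f = begin
  sumBelow (a ℕ.+ n) f + f (a ℕ.+ n)
    ≡⟨ cong (_+ f (a ℕ.+ n)) (sum-split n a f) ⟩
  sumBelow n f + rest + f (a ℕ.+ n)
    ≡⟨ solve 3 (λ x y z → x :+ y :+ z := x :+ (z :+ y)) refl (sumBelow n f) rest (f (a ℕ.+ n)) ⟩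
  sumBelow n f + (f (a ℕ.+ n) + rest)
    ≡⟨ cong (_+_ (sumBelow n f)) (sum-front a (λ i → f (suc a ℕ.+ n ∸ suc i))) ⟨
  sumBelow n f + Σ[ i < suc a ] f (suc a ℕ.+ n ∸ suc i) ∎
  where rest = Σ[ i < a ] f (a ℕ.+ n ∸ suc i)

-- Formal power series

infix 4 _≗ˢ_

-- Equality of all coefficients.
_≗ˢ_ : Series → Series → Set
f ≗ˢ g = ∀ n → f n ≡ g n

-- Multiplication by t.
delay : Series → Series
delay s zero    = 0ℚ
delay s (suc n) = s n

-- Multiplication by t ^ k.
shift : ℕ → Series → Series
shift zero    s = s
shift (suc k) s = delay (shift k s)

-- (s - s 0) / t.
tail : Series → Series
tail s n = s (suc n)

delay-cong : ∀ {s s′} → s ≗ˢ s′ → delay s ≗ˢ delay s′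
delay-cong eq zero    = refl
delay-cong eq (suc n) = eq n

shift-cong : ∀ k {s s′} → s ≗ˢ s′ → shift k s ≗ˢ shift k s′
shift-cong zero    eq = eq
shift-cong (suc k) eq = delay-cong (shift-cong k eq)

shift-below : ∀ k s {n} → n ℕ.< k → shift k s n ≡ 0ℚ
shift-below (suc k) s {zero}  _         = refl
shift-below (suc k) s {suc n} (s≤s n<k) = shift-below k s n<k

shift-above : ∀ k s {n} → k ℕ.≤ n → shift k s n ≡ s (n ∸ k)
shift-above zero    s _         = refl
shift-above (suc k) s (s≤s k≤n) = shift-above k s k≤n

shift-diagonal : ∀ n s → shift n s n ≡ s 0
shift-diagonal n s = trans (shift-above n s ℕ.≤-refl) (cong s (ℕ.n∸n≡0 n))

shift-1ˢ-above : ∀ {n m} → n ℕ.< m → shift n 1ˢ m ≡ 0ℚ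
shift-1ˢ-above {zero}  (s≤s _)   = refl
shift-1ˢ-above {suc n} (s≤s n<m) = shift-1ˢ-above n<m

-- Splits a into its constant term and a multiple of t.
*ˢ-unfold : ∀ a s n → (a *ˢ s) n ≡ a 0 * s n + delay (tail a *ˢ s) n
*ˢ-unfold a s zero    = ℚ.+-comm 0ℚ (a 0 * s 0)
*ˢ-unfold a s (suc n) = sum-front (suc n) (λ i → a i * s (suc n ∸ i))

*ˢ-congˡ : ∀ {a b} s → a ≗ˢ b → a *ˢ s ≗ˢ b *ˢ s
*ˢ-congˡ s eq n = sum-cong (suc n) (λ i _ → cong (_* s (n ∸ i)) (eq i))

-- The coefficient of tⁿ in a product only involves coefficients up to tⁿ.
*ˢ-congʳ : ∀ a {s s′} n → (∀ j → j ℕ.≤ n → s j ≡ s′ j) → (a *ˢ s) n ≡ (a *ˢ s′) n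
*ˢ-congʳ a n eq = sum-cong (suc n) (λ i _ → cong (a i *_) (eq (n ∸ i) (ℕ.m∸n≤m n i)))

*ˢ-zeroʳ : ∀ a {s} n → (∀ j → j ℕ.≤ n → s j ≡ 0ℚ) → (a *ˢ s) n ≡ 0ℚ
*ˢ-zeroʳ a n eq = sum-zero (suc n)
  (λ i _ → trans (cong (a i *_) (eq (n ∸ i) (ℕ.m∸n≤m n i))) (ℚ.*-zeroʳ (a i)))

*ˢ-+ʳ : ∀ a s s′ n → (a *ˢ (λ j → s j + s′ j)) n ≡ (a *ˢ s) n + (a *ˢ s′) n
*ˢ-+ʳ a s s′ n = trans
  (sum-cong (suc n) (λ i _ → ℚ.*-distribˡ-+ (a i) _ _))
  (sum-+ (suc n) (λ i → a i * s (n ∸ i)) (λ i → a i * s′ (n ∸ i)))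

*ˢ-scaleʳ : ∀ a c s n → (a *ˢ (λ j → c * s j)) n ≡ c * (a *ˢ s) n
*ˢ-scaleʳ a c s n = trans
  (sum-cong (suc n) (λ i _ →
    solve 3 (λ x y z → x :* (y :* z) := y :* (x :* z)) refl (a i) c (s (n ∸ i))))
  (sum-*ˡ (suc n) c (λ i → a i * s (n ∸ i)))

*ˢ-sumʳ : ∀ a K (c : ℕ → ℚ) (s : ℕ → Series) n →
  (a *ˢ (λ j → Σ[ k < K ] (c k * s k j))) n ≡ Σ[ k < K ] (c k * (a *ˢ s k) n)
*ˢ-sumʳ a zero    c s n = *ˢ-zeroʳ a n (λ _ _ → refl)
*ˢ-sumʳ a (suc K) c s n = begin
  (a *ˢ (λ j → (Σ[ k < K ] (c k * s k j)) + c K * s K j)) n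
    ≡⟨ *ˢ-+ʳ a (λ j → Σ[ k < K ] (c k * s k j)) (λ j → c K * s K j) n ⟩
  (a *ˢ (λ j → Σ[ k < K ] (c k * s k j))) n + (a *ˢ (λ j → c K * s K j)) n
    ≡⟨ cong₂ _+_ (*ˢ-sumʳ a K c s n) (*ˢ-scaleʳ a (c K) (s K) n) ⟩
  (Σ[ k < K ] (c k * (a *ˢ s k) n)) + c K * (a *ˢ s K) n ∎

*ˢ-delay : ∀ a s → a *ˢ delay s ≗ˢ delay (a *ˢ s)
*ˢ-delay a s zero    = trans (ℚ.+-identityˡ _) (ℚ.*-zeroʳ (a 0))
*ˢ-delay a s (suc n) = begin
  sumBelow (suc n) (λ i → a i * delay s (suc n ∸ i)) + a (suc n) * delay s (n ∸ n)
    ≡⟨ cong₂ _+_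
         (sum-cong (suc n) (λ i i≤n → cong (λ z → a i * delay s z) (ℕ.+-∸-assoc 1 (ℕ.≤-pred i≤n))))
         (trans (cong (λ z → a (suc n) * delay s z) (ℕ.n∸n≡0 n)) (ℚ.*-zeroʳ (a (suc n)))) ⟩
  (a *ˢ s) n + 0ℚ
    ≡⟨ ℚ.+-identityʳ _ ⟩
  (a *ˢ s) n ∎

*ˢ-shift : ∀ a k s → a *ˢ shift k s ≗ˢ shift k (a *ˢ s)
*ˢ-shift a zero    s n = refl
*ˢ-shift a (suc k) s n = trans (*ˢ-delay a (shift k s) n) (delay-cong (*ˢ-shift a k s) n)

-- Multiplication by b commutes with scalars and with t, and a is a scalar
-- plus t times its tail; the induction is on the coefficient.
*ˢ-leftComm : ∀ a b s → b *ˢ (a *ˢ s) ≗ˢ a *ˢ (b *ˢ s)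
*ˢ-leftComm a b s n = begin
  (b *ˢ (a *ˢ s)) n
    ≡⟨ *ˢ-congʳ b n (λ j _ → *ˢ-unfold a s j) ⟩
  (b *ˢ (λ j → a 0 * s j + delay (tail a *ˢ s) j)) n
    ≡⟨ *ˢ-+ʳ b (λ j → a 0 * s j) (delay (tail a *ˢ s)) n ⟩
  (b *ˢ (λ j → a 0 * s j)) n + (b *ˢ delay (tail a *ˢ s)) n
    ≡⟨ cong₂ _+_ (*ˢ-scaleʳ b (a 0) s n)
         (trans (*ˢ-delay b (tail a *ˢ s) n) (step n)) ⟩
  a 0 * (b *ˢ s) n + delay (tail a *ˢ (b *ˢ s)) n
    ≡⟨ *ˢ-unfold a (b *ˢ s) n ⟨
  (a *ˢ (b *ˢ s)) n ∎
  where
  step : ∀ n → delay (b *ˢ (tail a *ˢ s)) n ≡ delay (tail a *ˢ (b *ˢ s)) n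
  step zero    = refl
  step (suc n) = *ˢ-leftComm (tail a) b s n

-- A series with constant term 1 can be cancelled modulo t ^ M.
*ˢ-cancelˡ : ∀ a → a 0 ≡ 1ℚ → ∀ M {s s′} →
  (∀ j → j ℕ.< M → (a *ˢ s) j ≡ (a *ˢ s′) j) → ∀ j → j ℕ.< M → s j ≡ s′ j
*ˢ-cancelˡ a a₀ (suc M) {s} {s′} eq j (s≤s j≤M) with ℕ.m≤n⇒m<n∨m≡n j≤M
... | inj₁ j<M  = *ˢ-cancelˡ a a₀ M {s} {s′} (λ i i<M → eq i (ℕ.m<n⇒m<1+n i<M)) j j<M
... | inj₂ refl = begin
  s j                                          ≡⟨ isolate s ⟩
  (a *ˢ s) j - delay (tail a *ˢ s) j           ≡⟨ cong₂ _-_ (eq j ℕ.≤-refl) (rest j eq) ⟩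
  (a *ˢ s′) j - delay (tail a *ˢ s′) j         ≡⟨ isolate s′ ⟨
  s′ j                                         ∎
  where
  isolate : ∀ s → s j ≡ (a *ˢ s) j - delay (tail a *ˢ s) j
  isolate s = begin
    s j
      ≡⟨ solve 2 (λ x y → x := con 1ℚ :* x :+ y :- y) refl (s j) (delay (tail a *ˢ s) j) ⟩
    1ℚ * s j + delay (tail a *ˢ s) j - delay (tail a *ˢ s) j
      ≡⟨ cong (λ z → z * s j + delay (tail a *ˢ s) j - delay (tail a *ˢ s) j) a₀ ⟨
    a 0 * s j + delay (tail a *ˢ s) j - delay (tail a *ˢ s) j
      ≡⟨ cong (_- delay (tail a *ˢ s) j) (*ˢ-unfold a s j) ⟨
    (a *ˢ s) j - delay (tail a *ˢ s) j ∎
  rest : ∀ j → (∀ i → i ℕ.< suc j → (a *ˢ s) i ≡ (a *ˢ s′) i) →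
    delay (tail a *ˢ s) j ≡ delay (tail a *ˢ s′) j
  rest zero    eq = refl
  rest (suc j) eq = *ˢ-congʳ (tail a) {s} {s′} j (λ i i≤j →
    *ˢ-cancelˡ a a₀ (suc j) {s} {s′} (λ i i<1+j → eq i (ℕ.m<n⇒m<1+n i<1+j)) i (s≤s i≤j))

-- Powers of a series

binomial-absorb : ∀ x k →
  binomial (x + 1ℚ) (suc k) ≡ (x + 1ℚ) * binomial x k * (+ 1 / suc k)
binomial-absorb x zero    = solve 1 (λ x →
  con 1ℚ :* (x :+ con 1ℚ :- con 0ℚ) :* con 1ℚ := (x :+ con 1ℚ) :* con 1ℚ :* con 1ℚ) refl x
binomial-absorb x (suc k) = begin
  binomial (x + 1ℚ) (suc k) * (x + 1ℚ - fromℕ (suc k)) * r′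
    ≡⟨ cong₂ (λ u v → u * (x + 1ℚ - v) * r′) (binomial-absorb x k) (fromℕ-suc k) ⟩
  (x + 1ℚ) * binomial x k * r * (x + 1ℚ - (fromℕ k + 1ℚ)) * r′
    ≡⟨ solve 5 (λ x b r n r′ →
         (x :+ con 1ℚ) :* b :* r :* (x :+ con 1ℚ :- (n :+ con 1ℚ)) :* r′ :=
         (x :+ con 1ℚ) :* (b :* (x :- n) :* r) :* r′) refl
         x (binomial x k) r (fromℕ k) r′ ⟩
  (x + 1ℚ) * binomial x (suc k) * r′ ∎
  where
  r  = + 1 / suc k
  r′ = + 1 / suc (suc k)

pascal : ∀ x k → binomial (x + 1ℚ) (suc k) ≡ binomial x k + binomial x (suc k)
pascal x k = begin
  binomial (x + 1ℚ) (suc k)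
    ≡⟨ binomial-absorb x k ⟩
  (x + 1ℚ) * b * r
    ≡⟨ solve 4 (λ x b r n → (x :+ con 1ℚ) :* b :* r :=
         b :* ((n :+ con 1ℚ) :* r) :+ b :* (x :- n) :* r) refl x b r (fromℕ k) ⟩
  b * ((fromℕ k + 1ℚ) * r) + b * (x - fromℕ k) * r
    ≡⟨ cong (λ z → b * (z * r) + b * (x - fromℕ k) * r) (fromℕ-suc k) ⟨
  b * (fromℕ (suc k) * r) + b * (x - fromℕ k) * r
    ≡⟨ cong (λ z → b * z + b * (x - fromℕ k) * r) (suc*recip k) ⟩
  b * 1ℚ + b * (x - fromℕ k) * r
    ≡⟨ cong (_+ b * (x - fromℕ k) * r) (ℚ.*-identityʳ b) ⟩
  b + b * (x - fromℕ k) * r ∎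
  where
  b = binomial x k
  r = + 1 / suc k

binomial-zero : ∀ k → binomial 0ℚ (suc k) ≡ 0ℚ
binomial-zero zero    = refl
binomial-zero (suc k) = begin
  binomial 0ℚ (suc k) * y * z  ≡⟨ cong (λ u → u * y * z) (binomial-zero k) ⟩
  0ℚ * y * z                   ≡⟨ cong (_* z) (ℚ.*-zeroˡ y) ⟩
  0ℚ * z                       ≡⟨ ℚ.*-zeroˡ z ⟩
  0ℚ                           ∎
  where
  y = 0ℚ - fromℕ (suc k)
  z = + 1 / suc (suc k)

-- A series without constant term has a k-th power divisible by t ^ k.
^ˢ-below : ∀ g → g 0 ≡ 0ℚ → ∀ k {n} → n ℕ.< k → (g ^ˢ k) n ≡ 0ℚ
^ˢ-below g g₀ (suc k) {n} (s≤s n≤k) = begin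
  (g *ˢ (g ^ˢ k)) n                              ≡⟨ *ˢ-unfold g (g ^ˢ k) n ⟩
  g 0 * (g ^ˢ k) n + delay (tail g *ˢ (g ^ˢ k)) n ≡⟨ cong₂ _+_ (trans (cong (_* (g ^ˢ k) n) g₀) (ℚ.*-zeroˡ ((g ^ˢ k) n))) (rest n n≤k) ⟩
  0ℚ + 0ℚ                                        ≡⟨⟩
  0ℚ                                             ∎
  where
  rest : ∀ n → n ℕ.≤ k → delay (tail g *ˢ (g ^ˢ k)) n ≡ 0ℚ
  rest zero    _     = refl
  rest (suc n) 1+n≤k = *ˢ-zeroʳ (tail g) n (λ j j≤n → ^ˢ-below g g₀ k (ℕ.≤-<-trans j≤n 1+n≤k))

power-zero : ∀ f → power f 0ℚ ≗ˢ 1ˢ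
power-zero f n = begin
  power f 0ℚ n
    ≡⟨ sum-front n (λ k → binomial 0ℚ k * (g ^ˢ k) n) ⟩
  1ℚ * 1ˢ n + sumBelow n (λ k → binomial 0ℚ (suc k) * (g ^ˢ suc k) n)
    ≡⟨ cong₂ _+_ (ℚ.*-identityˡ (1ˢ n)) (sum-zero n (λ k _ →
         trans (cong (_* (g ^ˢ suc k) n) (binomial-zero k)) (ℚ.*-zeroˡ ((g ^ˢ suc k) n)))) ⟩
  1ˢ n + 0ℚ
    ≡⟨ ℚ.+-identityʳ _ ⟩
  1ˢ n ∎
  where g = f -ˢ 1ˢ

module _ (f : Series) (f₀ : f 0 ≡ 1ℚ) where

  private
    g : Series
    g = f -ˢ 1ˢ

    g₀ : g 0 ≡ 0ℚ
    g₀ = cong (_- 1ℚ) f₀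

    1+g : ∀ s n → (f *ˢ s) n ≡ s n + (g *ˢ s) n
    1+g s n = begin
      (f *ˢ s) n
        ≡⟨ *ˢ-unfold f s n ⟩
      f 0 * s n + delay (tail f *ˢ s) n
        ≡⟨ cong₂ _+_ (trans (cong (_* s n) f₀) (ℚ.*-identityˡ (s n)))
             (delay-cong (*ˢ-congˡ s (λ j → sym (ℚ.+-identityʳ (f (suc j))))) n) ⟩
      s n + delay (tail g *ˢ s) n
        ≡⟨ cong (_+_ (s n)) (trans (cong (_+ delay (tail g *ˢ s) n) (trans (cong (_* s n) g₀) (ℚ.*-zeroˡ (s n)))) (ℚ.+-identityˡ (delay (tail g *ˢ s) n))) ⟨
      s n + (g 0 * s n + delay (tail g *ˢ s) n)
        ≡⟨ cong (_+_ (s n)) (*ˢ-unfold g s n) ⟨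
      s n + (g *ˢ s) n ∎

    -- The number of terms of the binomial series may be enlarged.
    power-extend : ∀ x d n → power f x n ≡ Σ[ k < d ℕ.+ suc n ] (binomial x k * (g ^ˢ k) n)
    power-extend x d n = sym (sum-extend (suc n) d (λ k n<k →
      trans (cong (binomial x k *_) (^ˢ-below g g₀ k n<k)) (ℚ.*-zeroʳ (binomial x k))))

  -- With g = f - 1, Pascal's rule gives f ^ (x + 1) = f ^ x + g f ^ x for
  -- every exponent x, natural or not.
  power-suc : ∀ x → power f (x + 1ℚ) ≗ˢ f *ˢ power f x
  power-suc x n = begin
    power f (x + 1ℚ) n
      ≡⟨ power-extend (x + 1ℚ) 1 n ⟩
    Σ[ k < suc (suc n) ] (binomial (x + 1ℚ) k * (g ^ˢ k) n)
      ≡⟨ sum-front (suc n) (λ k → binomial (x + 1ℚ) k * (g ^ˢ k) n) ⟩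
    b₀ + Σ[ k < suc n ] (binomial (x + 1ℚ) (suc k) * (g ^ˢ suc k) n)
      ≡⟨ cong (_+_ b₀) (sum-cong (suc n) (λ k _ →
           trans (cong (_* (g ^ˢ suc k) n) (pascal x k)) (ℚ.*-distribʳ-+ _ (binomial x k) (binomial x (suc k))))) ⟩
    b₀ + Σ[ k < suc n ] (binomial x k * (g ^ˢ suc k) n + binomial x (suc k) * (g ^ˢ suc k) n)
      ≡⟨ cong (_+_ b₀) (sum-+ (suc n) _ _) ⟩
    b₀ + (Σ₁ + Σ₂)
      ≡⟨ solve 3 (λ x y z → x :+ (y :+ z) := (x :+ z) :+ y) refl b₀ Σ₁ Σ₂ ⟩
    (b₀ + Σ₂) + Σ₁
      ≡⟨ cong₂ _+_ (trans (power-extend x 1 n) (sum-front (suc n) (λ k → binomial x k * (g ^ˢ k) n))) product ⟨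
    power f x n + (g *ˢ power f x) n
      ≡⟨ 1+g (power f x) n ⟨
    (f *ˢ power f x) n ∎
    where
    b₀ = 1ℚ * 1ˢ n
    Σ₁ = Σ[ k < suc n ] (binomial x k * (g ^ˢ suc k) n)
    Σ₂ = Σ[ k < suc n ] (binomial x (suc k) * (g ^ˢ suc k) n)
    product : (g *ˢ power f x) n ≡ Σ₁
    product = begin
      (g *ˢ power f x) n
        ≡⟨ *ˢ-congʳ g n (λ j j≤n → trans (power-extend x (n ∸ j) j)
             (cong (λ K → sumBelow K (λ k → binomial x k * (g ^ˢ k) j))
               (trans (ℕ.+-suc (n ∸ j) j) (cong suc (ℕ.m∸n+n≡m j≤n))))) ⟩
      (g *ˢ (λ j → Σ[ k < suc n ] (binomial x k * (g ^ˢ k) j))) n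
        ≡⟨ *ˢ-sumʳ g (suc n) (binomial x) (g ^ˢ_) n ⟩
      Σ₁ ∎

-- Differentiating a power

-- The Euler operator t d/dt.
θ : Series → Series
θ s n = fromℕ n * s n

-- θ is a derivation.
θ-*ˢ : ∀ a s n → θ (a *ˢ s) n ≡ (θ a *ˢ s) n + (a *ˢ θ s) n
θ-*ˢ a s n = begin
  fromℕ n * (a *ˢ s) n
    ≡⟨ sum-*ˡ (suc n) (fromℕ n) (λ i → a i * s (n ∸ i)) ⟨
  Σ[ i < suc n ] (fromℕ n * (a i * s (n ∸ i)))
    ≡⟨ sum-cong (suc n) (λ i i≤n → trans
         (cong (λ z → z * (a i * s (n ∸ i))) (trans
           (cong fromℕ (sym (ℕ.m+[n∸m]≡n (ℕ.≤-pred i≤n)))) (fromℤ-+ (+ i) (+ (n ∸ i)))))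
         (solve 4 (λ x y u v → (x :+ y) :* (u :* v) := x :* u :* v :+ u :* (y :* v)) refl
           (fromℕ i) (fromℕ (n ∸ i)) (a i) (s (n ∸ i)))) ⟩
  Σ[ i < suc n ] (θ a i * s (n ∸ i) + a i * θ s (n ∸ i))
    ≡⟨ sum-+ (suc n) (λ i → θ a i * s (n ∸ i)) (λ i → a i * θ s (n ∸ i)) ⟩
  (θ a *ˢ s) n + (a *ˢ θ s) n ∎

module _ (f : Series) (f₀ : f 0 ≡ 1ℚ) where

  -- The chain rule θ (f ^ (n + 1)) = (n + 1) f ^ n θ f.
  θ-power : ∀ n j → θ (power f (fromℕ (suc n))) j ≡ fromℕ (suc n) * (θ f *ˢ power f (fromℕ n)) j
  θ-power n j = begin
    fromℕ j * power f (fromℕ (suc n)) j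
      ≡⟨ cong (fromℕ j *_) (trans (cong (λ x → power f x j) (fromℕ-suc n)) (power-suc f f₀ (fromℕ n) j)) ⟩
    θ (f *ˢ power f (fromℕ n)) j
      ≡⟨ θ-*ˢ f (power f (fromℕ n)) j ⟩
    (θ f *ˢ power f (fromℕ n)) j + (f *ˢ θ (power f (fromℕ n))) j
      ≡⟨ cong (_+_ ((θ f *ˢ power f (fromℕ n)) j)) (rest n) ⟩
    (θ f *ˢ power f (fromℕ n)) j + fromℕ n * (θ f *ˢ power f (fromℕ n)) j
      ≡⟨ solve 2 (λ x y → x :+ y :* x := (y :+ con 1ℚ) :* x) refl ((θ f *ˢ power f (fromℕ n)) j) (fromℕ n) ⟩
    (fromℕ n + 1ℚ) * (θ f *ˢ power f (fromℕ n)) j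
      ≡⟨ cong (_* (θ f *ˢ power f (fromℕ n)) j) (fromℕ-suc n) ⟨
    fromℕ (suc n) * (θ f *ˢ power f (fromℕ n)) j ∎
    where
    rest : ∀ n → (f *ˢ θ (power f (fromℕ n))) j ≡ fromℕ n * (θ f *ˢ power f (fromℕ n)) j
    rest zero = trans (*ˢ-zeroʳ f j (λ i _ → trans (cong (fromℕ i *_) (power-zero f i)) (vanish i)))
                      (sym (ℚ.*-zeroˡ ((θ f *ˢ power f 0ℚ) j)))
      where
      vanish : ∀ i → fromℕ i * 1ˢ i ≡ 0ℚ
      vanish zero    = refl
      vanish (suc i) = ℚ.*-zeroʳ (fromℕ (suc i))
    rest (suc n) = begin
      (f *ˢ θ (power f (fromℕ (suc n)))) j
        ≡⟨ *ˢ-congʳ f j (λ i _ → θ-power n i) ⟩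
      (f *ˢ (λ i → fromℕ (suc n) * (θ f *ˢ power f (fromℕ n)) i)) j
        ≡⟨ *ˢ-scaleʳ f (fromℕ (suc n)) (θ f *ˢ power f (fromℕ n)) j ⟩
      fromℕ (suc n) * (f *ˢ (θ f *ˢ power f (fromℕ n))) j
        ≡⟨ cong (fromℕ (suc n) *_) (*ˢ-leftComm (θ f) f (power f (fromℕ n)) j) ⟩
      fromℕ (suc n) * (θ f *ˢ (f *ˢ power f (fromℕ n))) j
        ≡⟨ cong (fromℕ (suc n) *_) (*ˢ-congʳ (θ f) j (λ i _ →
             trans (sym (power-suc f f₀ (fromℕ n) i)) (cong (λ x → power f x i) (sym (fromℕ-suc n))))) ⟩
      fromℕ (suc n) * (θ f *ˢ power f (fromℕ (suc n))) j ∎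

-- Counting paths of a given length

-- The number of paths of length k that satisfy P.
count : {P : Pred Path 0ℓ} → Decidable P → ℕ → ℕ
count P? k = length (filter P? (pathsOfLength k))

count-cong : {P Q : Pred Path 0ℓ} (P? : Decidable P) (Q? : Decidable Q) →
  (∀ {p} → P p → Q p) → (∀ {p} → Q p → P p) → ∀ k → count P? k ≡ count Q? k
count-cong P? Q? P⇒Q Q⇒P k = cong length (filter-≐ P? Q? (P⇒Q , Q⇒P) (pathsOfLength k))

count-none : {P : Pred Path 0ℓ} (P? : Decidable P) → (∀ {p} → ¬ P p) → ∀ k → count P? k ≡ 0
count-none P? none k = cong length (filter-none P? {xs = pathsOfLength k} (All.universal (λ _ → none) _))

length-filter-map : {P : Pred Path 0ℓ} (P? : Decidable P) (f : Path → Path) (ps : List Path) →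
  length (filter P? (map f ps)) ≡ length (filter (P? ∘ f) ps)
length-filter-map P? f []       = refl
length-filter-map P? f (p ∷ ps) with does (P? (f p))
... | false = length-filter-map P? f ps
... | true  = cong suc (length-filter-map P? f ps)

count-cons : {P : Pred Path 0ℓ} (P? : Decidable P) → ∀ k →
  count P? (suc k) ≡ count (P? ∘ (north ∷_)) k ℕ.+ count (P? ∘ (east ∷_)) k
count-cons P? k = begin
  length (filter P? (map (north ∷_) ps ++ map (east ∷_) ps ++ []))
    ≡⟨ cong length (filter-++ P? (map (north ∷_) ps) _) ⟩
  length (filter P? (map (north ∷_) ps) ++ filter P? (map (east ∷_) ps ++ []))
    ≡⟨ length-++ (filter P? (map (north ∷_) ps)) ⟩
  length (filter P? (map (north ∷_) ps)) ℕ.+ length (filter P? (map (east ∷_) ps ++ []))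
    ≡⟨ cong₂ ℕ._+_ (length-filter-map P? (north ∷_) ps)
         (trans (cong (length ∘ filter P?) (++-identityʳ (map (east ∷_) ps))) (length-filter-map P? (east ∷_) ps)) ⟩
  count (P? ∘ (north ∷_)) k ℕ.+ count (P? ∘ (east ∷_)) k ∎
  where ps = pathsOfLength k

count-snoc : {P : Pred Path 0ℓ} (P? : Decidable P) → ∀ k →
  count P? (suc k) ≡ count (P? ∘ (_∷ʳ north)) k ℕ.+ count (P? ∘ (_∷ʳ east)) k
count-snoc P? zero    with does (P? (north ∷ []))
... | true  with does (P? (east ∷ []))
...   | true  = refl
...   | false = refl
count-snoc P? zero | false with does (P? (east ∷ []))
...   | true  = refl
...   | false = refl
count-snoc P? (suc k) = begin
  count P? (suc (suc k))
    ≡⟨ count-cons P? (suc k) ⟩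
  count (P? ∘ (north ∷_)) (suc k) ℕ.+ count (P? ∘ (east ∷_)) (suc k)
    ≡⟨ cong₂ ℕ._+_ (count-snoc (P? ∘ (north ∷_)) k) (count-snoc (P? ∘ (east ∷_)) k) ⟩
  (nn ℕ.+ ne) ℕ.+ (en ℕ.+ ee)
    ≡⟨ interchange nn ne en ee ⟩
  (nn ℕ.+ en) ℕ.+ (ne ℕ.+ ee)
    ≡⟨ cong₂ ℕ._+_ (count-cons (P? ∘ (_∷ʳ north)) k) (count-cons (P? ∘ (_∷ʳ east)) k) ⟨
  count (P? ∘ (_∷ʳ north)) (suc k) ℕ.+ count (P? ∘ (_∷ʳ east)) (suc k) ∎
  where
  open import Algebra.Properties.CommutativeSemigroup ℕ.+-commutativeSemigroup using (interchange)
  nn = count (P? ∘ (λ p → north ∷ p ∷ʳ north)) k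
  ne = count (P? ∘ (λ p → north ∷ p ∷ʳ east)) k
  en = count (P? ∘ (λ p → east ∷ p ∷ʳ north)) k
  ee = count (P? ∘ (λ p → east ∷ p ∷ʳ east)) k

-- Reversal permutes the paths of a given length.
count-reverse : {P : Pred Path 0ℓ} (P? : Decidable P) → ∀ k → count P? k ≡ count (P? ∘ reverse) k
count-reverse P? zero    with does (P? [])
... | true  = refl
... | false = refl
count-reverse {P} P? (suc k) = begin
  count P? (suc k)
    ≡⟨ count-snoc P? k ⟩
  count (P? ∘ (_∷ʳ north)) k ℕ.+ count (P? ∘ (_∷ʳ east)) k
    ≡⟨ cong₂ ℕ._+_ (step north) (step east) ⟩
  count (P? ∘ reverse ∘ (north ∷_)) k ℕ.+ count (P? ∘ reverse ∘ (east ∷_)) k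
    ≡⟨ count-cons (P? ∘ reverse) k ⟨
  count (P? ∘ reverse) (suc k) ∎
  where
  step : ∀ s → count (P? ∘ (_∷ʳ s)) k ≡ count (P? ∘ reverse ∘ (s ∷_)) k
  step s = trans (count-reverse (P? ∘ (_∷ʳ s)) k)
    (count-cong (P? ∘ (_∷ʳ s) ∘ reverse) (P? ∘ reverse ∘ (s ∷_))
      (λ {p} → subst P (sym (unfold-reverse s p))) (λ {p} → subst P (unfold-reverse s p)) k)

-- Reversed ballot paths

-- The end point of the path lies weakly above the diagonal.
AboveDiagonal : Path → Set
AboveDiagonal p = xEnd p ℕ.≤ yEnd p

-- A run of u north steps.
Run : ℕ → Path
Run u = replicate u north

-- A ballot path to (n , m) without r consecutive north steps, listed from its
-- last step to its first, whose final run of north steps is shorter than u.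
-- Reading backwards, the vertices of the path correspond to the tails of the
-- list, and the final run to a prefix.
Reversed : (n m r u : ℕ) → Path → Set
Reversed n m r u p =
  (xEnd p ≡ n × yEnd p ≡ m) × All AboveDiagonal (tails p)
  × ¬ Prefix _≡_ (Run u) p × ¬ Infix _≡_ (Run r) p

reversed? : ∀ n m r u → Decidable (Reversed n m r u)
reversed? n m r u p =
  ((xEnd p ℕ.≟ n) ×-dec (yEnd p ℕ.≟ m))
  ×-dec all? (λ q → xEnd q ℕ.≤? yEnd q) (tails p)
  ×-dec ¬? (prefix? _≟_ (Run u) p)
  ×-dec ¬? (infix? _≟_ (Run r) p)

inits-∷ʳ : ∀ {A : Set} (xs : List A) x → inits (xs ∷ʳ x) ≡ inits xs ∷ʳ (xs ∷ʳ x)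
inits-∷ʳ []       x = refl
inits-∷ʳ (y ∷ ys) x = cong ([] ∷_) (trans (cong (map (y ∷_)) (inits-∷ʳ ys x)) (map-++ (y ∷_) (inits ys) _))

length-filter-reverse : ∀ {A : Set} {P : Pred A 0ℓ} (P? : Decidable P) xs →
  length (filter P? (reverse xs)) ≡ length (filter P? xs)
length-filter-reverse P? []       = refl
length-filter-reverse P? (x ∷ xs) = begin
  length (filter P? (reverse (x ∷ xs)))                ≡⟨ cong (length ∘ filter P?) (unfold-reverse x xs) ⟩
  length (filter P? (reverse xs ∷ʳ x))                 ≡⟨ cong length (filter-++ P? (reverse xs) [ x ]) ⟩
  length (filter P? (reverse xs) ++ filter P? [ x ])   ≡⟨ length-++ (filter P? (reverse xs)) ⟩
  length (filter P? (reverse xs)) ℕ.+ length (filter P? [ x ])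
    ≡⟨ cong (ℕ._+ length (filter P? [ x ])) (length-filter-reverse P? xs) ⟩
  length (filter P? xs) ℕ.+ length (filter P? [ x ])   ≡⟨ ℕ.+-comm _ (length (filter P? [ x ])) ⟩
  length (filter P? [ x ]) ℕ.+ length (filter P? xs)   ≡⟨ length-++ (filter P? [ x ]) ⟨
  length (filter P? [ x ] ++ filter P? xs)             ≡⟨ cong length (filter-++ P? [ x ] xs) ⟨
  length (filter P? (x ∷ xs))                          ∎

reverse-replicate : ∀ {A : Set} n (x : A) → reverse (replicate n x) ≡ replicate n x
reverse-replicate zero    x = refl
reverse-replicate (suc n) x =
  trans (unfold-reverse x (replicate n x)) (trans (cong (_∷ʳ x) (reverse-replicate n x)) (snoc n))
  where
  snoc : ∀ n → replicate n x ∷ʳ x ≡ x ∷ replicate n x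
  snoc zero    = refl
  snoc (suc n) = cong (x ∷_) (snoc n)

infix-reverse : ∀ {A : Set} {xs ys : List A} → Infix _≡_ xs ys → Infix _≡_ (reverse xs) (reverse ys)
infix-reverse i with toView i
... | MkView pref {inf} pw suff with refl ← Pointwise-≡⇒≡ pw =
  subst (Infix _≡_ (reverse inf)) (sym eq)
    (fromView (MkView (reverse suff) (≡⇒Pointwise-≡ refl) (reverse pref)))
  where
  eq : reverse (pref ++ inf ++ suff) ≡ reverse suff ++ reverse inf ++ reverse pref
  eq = begin
    reverse (pref ++ inf ++ suff)                  ≡⟨ reverse-++ pref (inf ++ suff) ⟩
    reverse (inf ++ suff) ++ reverse pref          ≡⟨ cong (_++ reverse pref) (reverse-++ inf suff) ⟩
    (reverse suff ++ reverse inf) ++ reverse pref  ≡⟨ ++-assoc (reverse suff) _ _ ⟩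
    reverse suff ++ reverse inf ++ reverse pref    ∎

above-reverse⁺ : ∀ p → All AboveDiagonal (tails p) → WeaklyAboveDiagonal (reverse p)
above-reverse⁺ []      _        = z≤n ∷ []
above-reverse⁺ (s ∷ p) (h ∷ hs) =
  subst WeaklyAboveDiagonal (sym (unfold-reverse s p))
    (subst (All AboveDiagonal) (sym (inits-∷ʳ (reverse p) s))
      (All.∷ʳ⁺ (above-reverse⁺ p hs)
        (subst AboveDiagonal (unfold-reverse s p)
          (subst₂ ℕ._≤_ (sym (length-filter-reverse (_≟ east) (s ∷ p)))
                        (sym (length-filter-reverse (_≟ north) (s ∷ p))) h))))

above-reverse⁻ : ∀ p → WeaklyAboveDiagonal (reverse p) → All AboveDiagonal (tails p)
above-reverse⁻ []      _  = z≤n ∷ []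
above-reverse⁻ (s ∷ p) hs with All.∷ʳ⁻ (subst (All AboveDiagonal) (inits-∷ʳ (reverse p) s)
                                 (subst WeaklyAboveDiagonal (unfold-reverse s p) hs))
... | hs′ , h =
  subst₂ ℕ._≤_ (length-filter-reverse (_≟ east) (s ∷ p)) (length-filter-reverse (_≟ north) (s ∷ p))
    (subst AboveDiagonal (sym (unfold-reverse s p)) h)
  ∷ above-reverse⁻ p hs′

avoids-reverse : ∀ r p → Avoids r p → Avoids r (reverse p)
avoids-reverse r p avoids i = avoids
  (subst₂ (Infix _≡_) (reverse-replicate r north) (reverse-involutive p) (infix-reverse i))

ballot⇒reversed : ∀ {n m r} p → BallotPath n m r (reverse p) → Reversed n m r r p
ballot⇒reversed {r = r} p ((x≡n , y≡m) , above , avoids) =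
  (trans (sym (length-filter-reverse (_≟ east) p)) x≡n , trans (sym (length-filter-reverse (_≟ north) p)) y≡m)
  , above-reverse⁻ p above , avoids′ ∘ here , avoids′
  where
  avoids′ : Avoids r p
  avoids′ = subst (Avoids r) (reverse-involutive p) (avoids-reverse r (reverse p) avoids)

reversed⇒ballot : ∀ {n m r} p → Reversed n m r r p → BallotPath n m r (reverse p)
reversed⇒ballot {r = r} p ((x≡n , y≡m) , above , _ , avoids) =
  (trans (length-filter-reverse (_≟ east) p) x≡n , trans (length-filter-reverse (_≟ north) p) y≡m)
  , above-reverse⁺ p above , avoids-reverse r p avoids

-- Removing the last step of a ballot path

reversed-above : ∀ {n m r u} p → Reversed n m r u p → n ℕ.≤ m
reversed-above []      ((refl , refl) , (h ∷ _) , _) = h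
reversed-above (s ∷ p) ((refl , refl) , (h ∷ _) , _) = h

north⁻ : ∀ {n m r u} p → Reversed n (suc m) r (suc u) (north ∷ p) → Reversed n m r u p
north⁻ p ((x , y) , (_ ∷ above) , noPrefix , avoids) =
  (x , ℕ.suc-injective y) , above , (λ q → noPrefix (refl ∷ q)) , (λ i → avoids (there i))

north⁺ : ∀ {n m r u} → suc u ℕ.≤ r → ∀ p → Reversed n m r u p → Reversed n (suc m) r (suc u) (north ∷ p)
north⁺ {r = r} {u} u<r p v@((x , y) , above , noPrefix , avoids) =
  (x , cong suc y)
  , ℕ.≤-trans (subst₂ ℕ._≤_ (sym x) (sym y) (reversed-above p v)) (ℕ.n≤1+n _) ∷ above
  , (λ { (_ ∷ q) → noPrefix q })
  , λ { (here q) → noPrefix (shorter u<r q) ; (there i) → avoids i }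
  where
  weaken : ∀ {u r p} → u ℕ.≤ r → Prefix _≡_ (Run r) p → Prefix _≡_ (Run u) p
  weaken z≤n       _       = []
  weaken (s≤s u≤r) (e ∷ q) = e ∷ weaken u≤r q
  shorter : ∀ {u r p} → suc u ℕ.≤ r → Prefix _≡_ (Run r) (north ∷ p) → Prefix _≡_ (Run u) p
  shorter (s≤s u≤r) (_ ∷ q) = weaken u≤r q

east⁻ : ∀ {n m r u} p → Reversed (suc n) m r (suc u) (east ∷ p) → Reversed n m r r p
east⁻ p ((x , y) , (_ ∷ above) , _ , avoids) =
  (ℕ.suc-injective x , y) , above , (λ q → avoids (there (here q))) , (λ i → avoids (there i))

east⁺ : ∀ {n m r u} → 0 ℕ.< r → n ℕ.< m → ∀ p → Reversed n m r r p → Reversed (suc n) m r (suc u) (east ∷ p)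
east⁺ (s≤s _) n<m p ((refl , refl) , above , _ , avoids) =
  (refl , refl) , n<m ∷ above , (λ { (() ∷ _) }) , λ { (here (() ∷ _)) ; (there i) → avoids i }

-- A final run shorter than u + 1 that ends with a north step leaves a run
-- shorter than u; avoidance is preserved because u + 1 is at most r.
T-north : ∀ {r u} n m k → suc u ℕ.≤ r →
  count (reversed? n (suc m) r (suc u) ∘ (north ∷_)) k ≡ count (reversed? n m r u) k
T-north {r} {u} n m k u<r = count-cong (reversed? n (suc m) r (suc u) ∘ (north ∷_)) (reversed? n m r u)
  (λ {p} → north⁻ p) (λ {p} → north⁺ u<r p) k

-- Only the lemmas of this block are needed of T, not the enumeration behind it.
abstract

  -- The number of ballot paths to (n , m) without r consecutive north steps
  -- whose final run of north steps is shorter than u.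
  T : (r u n m : ℕ) → ℕ
  T r u n m = count (reversed? n m r u) (n ℕ.+ m)

  -- A path without r consecutive north steps has a final run shorter than r.
  t≡T : ∀ n m r → t n m r ≡ T r r n m
  t≡T n m r = trans (count-reverse (ballotPath? n m r) (n ℕ.+ m))
    (count-cong (ballotPath? n m r ∘ reverse) (reversed? n m r r)
      (λ {p} → ballot⇒reversed p) (λ {p} → reversed⇒ballot p) (n ℕ.+ m))

  T-no-run : ∀ r n m → T r 0 n m ≡ 0
  T-no-run r n m = count-none (reversed? n m r 0) (λ (_ , _ , noPrefix , _) → noPrefix []) (n ℕ.+ m)

  T-below : ∀ r u {n m} → m ℕ.< n → T r u n m ≡ 0
  T-below r u {n} {m} m<n =
    count-none (reversed? n m r u) (λ {p} v → ℕ.<⇒≱ m<n (reversed-above p v)) (n ℕ.+ m)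

  T-origin : ∀ {r u} → suc u ℕ.≤ r → T r (suc u) 0 0 ≡ 1
  T-origin {r} {u} (s≤s _) = cong length (filter-accept (reversed? 0 0 r (suc u)) {xs = []}
    ((refl , refl) , (z≤n ∷ []) , (λ ()) , λ { (here ()) }))

  T-leftEdge : ∀ {r u} m → suc u ℕ.≤ r → T r (suc u) 0 (suc m) ≡ T r u 0 m
  T-leftEdge {r} {u} m u<r = begin
    count (reversed? 0 (suc m) r (suc u)) (suc m)
      ≡⟨ count-cons (reversed? 0 (suc m) r (suc u)) m ⟩
    count (reversed? 0 (suc m) r (suc u) ∘ (north ∷_)) m ℕ.+ count (reversed? 0 (suc m) r (suc u) ∘ (east ∷_)) m
      ≡⟨ cong₂ ℕ._+_ (T-north 0 m m u<r)
           (count-none (reversed? 0 (suc m) r (suc u) ∘ (east ∷_)) (λ { ((() , _) , _) }) m) ⟩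
    T r u 0 m ℕ.+ 0
      ≡⟨ ℕ.+-identityʳ _ ⟩
    T r u 0 m ∎

  -- Removing a final east step lifts the bound on the run before it to r.
  T-interior : ∀ {r u n m} → suc u ℕ.≤ r → n ℕ.≤ m →
    T r (suc u) (suc n) (suc m) ≡ T r u (suc n) m ℕ.+ T r r n (suc m)
  T-interior {r} {u} {n} {m} u<r n≤m = begin
    count (reversed? (suc n) (suc m) r (suc u)) (suc (n ℕ.+ suc m))
      ≡⟨ count-cons (reversed? (suc n) (suc m) r (suc u)) (n ℕ.+ suc m) ⟩
    count (reversed? (suc n) (suc m) r (suc u) ∘ (north ∷_)) (n ℕ.+ suc m)
    ℕ.+ count (reversed? (suc n) (suc m) r (suc u) ∘ (east ∷_)) (n ℕ.+ suc m)
      ≡⟨ cong₂ ℕ._+_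
           (trans (T-north (suc n) m (n ℕ.+ suc m) u<r) (cong (count (reversed? (suc n) m r u)) (ℕ.+-suc n m)))
           (count-cong (reversed? (suc n) (suc m) r (suc u) ∘ (east ∷_)) (reversed? n (suc m) r r)
             (λ {p} → east⁻ p) (λ {p} → east⁺ (ℕ.≤-trans (s≤s z≤n) u<r) (s≤s n≤m) p) (n ℕ.+ suc m)) ⟩
    T r u (suc n) m ℕ.+ T r r n (suc m) ∎

-- Generating functions of ballot paths

module _ (r : ℕ) (0<r : 0 ℕ.< r) where

  private
    -- 1 + t + ⋯ + t ^ (r - 1), the generating function of a single run.
    F : Series
    F = truncatedGeometric r

    F₀ : ∀ {r} → 0 ℕ.< r → truncatedGeometric r 0 ≡ 1ℚ
    F₀ (s≤s _) = refl

    -- P x is F ^ x.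
    P : ℚ → Series
    P = euler r

    P-suc : ∀ x → P (x + 1ℚ) ≗ˢ F *ˢ P x
    P-suc = power-suc F (F₀ 0<r)

    -- The generating function, by height, of the paths counted by T r u n.
    Tˢ : (u n : ℕ) → Series
    Tˢ u n m = fromℕ (T r u n m)

    -- The number of those that avoid r consecutive north steps and end at (n , n).
    C : ℕ → ℚ
    C n = Tˢ r n n

  -- The generating function, by height, of the ballot paths to x = n without r
  -- consecutive north steps that do not end with a north step.  For n > 0 these
  -- arise by an east step from the paths to x = n - 1, except from those that end
  -- on the diagonal.
  lastEast : ℕ → Series
  lastEast zero    = 1ˢ
  lastEast (suc n) = λ m → Tˢ r n m - C n * shift n 1ˢ m

  lastEast-above : ∀ {n m} → n ℕ.< m → lastEast (suc n) m ≡ Tˢ r n m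
  lastEast-above {n} {m} n<m = begin
    Tˢ r n m - C n * shift n 1ˢ m  ≡⟨ cong (λ z → Tˢ r n m - C n * z) (shift-1ˢ-above n<m) ⟩
    Tˢ r n m - C n * 0ℚ            ≡⟨ solve 2 (λ x y → x :- y :* con 0ℚ := x) refl (Tˢ r n m) (C n) ⟩
    Tˢ r n m                       ∎

  lastEast-below : ∀ {n m} → m ℕ.≤ n → lastEast (suc n) m ≡ 0ℚ
  lastEast-below {n} {m} m≤n with ℕ.m≤n⇒m<n∨m≡n m≤n
  ... | inj₁ m<n  = begin
    Tˢ r n m - C n * shift n 1ˢ m  ≡⟨ cong₂ (λ y z → fromℕ y - C n * z) (T-below r r m<n) (shift-below n 1ˢ m<n) ⟩
    0ℚ - C n * 0ℚ                  ≡⟨ solve 1 (λ y → con 0ℚ :- y :* con 0ℚ := con 0ℚ) refl (C n) ⟩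
    0ℚ                             ∎
  ... | inj₂ refl = begin
    C n - C n * shift n 1ˢ n       ≡⟨ cong (λ z → C n - C n * z) (shift-diagonal n 1ˢ) ⟩
    C n - C n * 1ℚ                 ≡⟨ solve 1 (λ y → y :- y :* con 1ℚ := con 0ℚ) refl (C n) ⟩
    0ℚ                             ∎

  -- A final run shorter than u + 1 is empty, or a north step that extends a run
  -- shorter than u.
  T-step : ∀ {u} n → suc u ℕ.≤ r → ∀ m → Tˢ (suc u) n m ≡ lastEast n m + delay (Tˢ u n) m
  T-step zero u<r zero    = cong fromℕ (T-origin u<r)
  T-step zero u<r (suc m) = trans (cong fromℕ (T-leftEdge m u<r)) (sym (ℚ.+-identityˡ _))
  T-step {u} (suc n) u<r zero =
    trans (cong fromℕ (T-below r (suc u) {suc n} {0} (s≤s z≤n)))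
          (sym (cong (_+ 0ℚ) (lastEast-below {n} {0} z≤n)))
  T-step {u} (suc n) u<r (suc m) with ℕ.≤-<-connex n m
  ... | inj₁ n≤m = begin
    Tˢ (suc u) (suc n) (suc m)
      ≡⟨ cong fromℕ (T-interior u<r n≤m) ⟩
    fromℕ (T r u (suc n) m ℕ.+ T r r n (suc m))
      ≡⟨ fromℤ-+ (+ T r u (suc n) m) (+ T r r n (suc m)) ⟩
    Tˢ u (suc n) m + Tˢ r n (suc m)
      ≡⟨ ℚ.+-comm (Tˢ u (suc n) m) (Tˢ r n (suc m)) ⟩
    Tˢ r n (suc m) + Tˢ u (suc n) m
      ≡⟨ cong (_+ Tˢ u (suc n) m) (lastEast-above (s≤s n≤m)) ⟨
    lastEast (suc n) (suc m) + Tˢ u (suc n) m ∎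
  ... | inj₂ m<n = begin
    Tˢ (suc u) (suc n) (suc m)
      ≡⟨ cong fromℕ (T-below r (suc u) (s≤s m<n)) ⟩
    0ℚ + 0ℚ
      ≡⟨ cong₂ _+_ (lastEast-below m<n) (cong fromℕ (T-below r u (ℕ.m<n⇒m<1+n m<n))) ⟨
    lastEast (suc n) (suc m) + Tˢ u (suc n) m ∎

  -- The final run is chosen independently of the path before it.
  T-runs : ∀ {u} n → u ℕ.≤ r → Tˢ u n ≗ˢ truncatedGeometric u *ˢ lastEast n
  T-runs {zero}  n _   m = trans (cong fromℕ (T-no-run r n m))
    (sym (sum-zero (suc m) (λ i _ → ℚ.*-zeroˡ (lastEast n (m ∸ i)))))
  T-runs {suc u} n u<r m = begin
    Tˢ (suc u) n m
      ≡⟨ T-step n u<r m ⟩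
    lastEast n m + delay (Tˢ u n) m
      ≡⟨ cong₂ _+_ (sym (ℚ.*-identityˡ (lastEast n m))) (delay-cong (T-runs n (ℕ.<⇒≤ u<r)) m) ⟩
    1ℚ * lastEast n m + delay (truncatedGeometric u *ˢ lastEast n) m
      ≡⟨ *ˢ-unfold (truncatedGeometric (suc u)) (lastEast n) m ⟨
    (truncatedGeometric (suc u) *ˢ lastEast n) m ∎

  -- The sum of C k t ^ k F ^ (x - k) over k < M.
  excess : (M : ℕ) → ℚ → Series
  excess M x j = Σ[ k < M ] (C k * shift k (P (x - fromℕ k)) j)

  F*excess : ∀ M x → F *ˢ excess M x ≗ˢ excess M (x + 1ℚ)
  F*excess M x j = trans (*ˢ-sumʳ F M C (λ k → shift k (P (x - fromℕ k))) j)
    (sum-cong M (λ k _ → cong (C k *_) (begin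
      (F *ˢ shift k (P (x - fromℕ k))) j    ≡⟨ *ˢ-shift F k (P (x - fromℕ k)) j ⟩
      shift k (F *ˢ P (x - fromℕ k)) j      ≡⟨ shift-cong k (P-suc (x - fromℕ k)) j ⟨
      shift k (P (x - fromℕ k + 1ℚ)) j      ≡⟨ cong (λ z → shift k (P z) j)
                                                 (solve 2 (λ x y → x :- y :+ con 1ℚ := x :+ con 1ℚ :- y) refl x (fromℕ k)) ⟩
      shift k (P (x + 1ℚ - fromℕ k)) j      ∎)))

  -- Among the sequences of n + 1 runs, counted by F ^ (n + 1), the excess
  -- accounts for those that cross the diagonal: C k t ^ k F ^ (n - k) for a
  -- first crossing that starts at (k , k).
  T-formula : ∀ n m → Tˢ r n m ≡ P (fromℕ (suc n)) m - excess n (fromℕ n) m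
  T-formula zero m = begin
    Tˢ r 0 m             ≡⟨ T-runs 0 ℕ.≤-refl m ⟩
    (F *ˢ 1ˢ) m          ≡⟨ *ˢ-congʳ F m (λ j _ → power-zero F j) ⟨
    (F *ˢ P 0ℚ) m        ≡⟨ P-suc 0ℚ m ⟨
    P 1ℚ m               ≡⟨ ℚ.+-identityʳ (P 1ℚ m) ⟨
    P 1ℚ m - 0ℚ          ∎
  T-formula (suc n) m = begin
    Tˢ r (suc n) m
      ≡⟨ T-runs (suc n) ℕ.≤-refl m ⟩
    (F *ˢ lastEast (suc n)) m
      ≡⟨ *ˢ-congʳ F m (λ j _ → expand j) ⟩
    (F *ˢ (λ j → P x j + (- 1ℚ) * excess (suc n) (fromℕ n) j)) m
      ≡⟨ *ˢ-+ʳ F (P x) (λ j → (- 1ℚ) * excess (suc n) (fromℕ n) j) m ⟩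
    (F *ˢ P x) m + (F *ˢ (λ j → (- 1ℚ) * excess (suc n) (fromℕ n) j)) m
      ≡⟨ cong₂ _+_ (trans (sym (P-suc x m)) (cong (λ z → P z m) (sym (fromℕ-suc (suc n)))))
           (trans (*ˢ-scaleʳ F (- 1ℚ) (excess (suc n) (fromℕ n)) m) (cong (- 1ℚ *_)
             (trans (F*excess (suc n) (fromℕ n) m) (cong (λ z → excess (suc n) z m) (sym (fromℕ-suc n)))))) ⟩
    P (fromℕ (suc (suc n))) m + (- 1ℚ) * excess (suc n) x m
      ≡⟨ solve 2 (λ x y → x :+ con (- 1ℚ) :* y := x :- y) refl (P (fromℕ (suc (suc n))) m) (excess (suc n) x m) ⟩
    P (fromℕ (suc (suc n))) m - excess (suc n) x m ∎
    where
    x = fromℕ (suc n)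
    expand : ∀ j → lastEast (suc n) j ≡ P x j + (- 1ℚ) * excess (suc n) (fromℕ n) j
    expand j = begin
      Tˢ r n j - C n * shift n 1ˢ j
        ≡⟨ cong₂ (λ y z → y - C n * z) (T-formula n j) (shift-cong n (λ i → trans
             (sym (power-zero F i)) (cong (λ z → P z i) (sym (ℚ.+-inverseʳ (fromℕ n))))) j) ⟩
      P x j - excess n (fromℕ n) j - C n * shift n (P (fromℕ n - fromℕ n)) j
        ≡⟨ solve 3 (λ x y z → x :- y :- z := x :+ con (- 1ℚ) :* (y :+ z)) refl
             (P x j) (excess n (fromℕ n) j) (C n * shift n (P (fromℕ n - fromℕ n)) j) ⟩
      P x j + (- 1ℚ) * excess (suc n) (fromℕ n) j ∎

  -- F ^ (n + 1) = excess M n modulo t ^ M whenever n ≤ M; here b = M - n.  For n = M this says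
  -- that no ballot path to x = M ends below the diagonal.  Since both sides are
  -- multiplied by F when n increases, and F is invertible, the congruence
  -- descends to smaller n.
  excess-full : ∀ b n j → j ℕ.< b ℕ.+ n → excess (b ℕ.+ n) (fromℕ n) j ≡ P (fromℕ (suc n)) j
  excess-full zero n j j<n = sym (begin
    P (fromℕ (suc n)) j
      ≡⟨ solve 2 (λ x y → x := x :- y :+ y) refl (P (fromℕ (suc n)) j) (excess n (fromℕ n) j) ⟩
    P (fromℕ (suc n)) j - excess n (fromℕ n) j + excess n (fromℕ n) j
      ≡⟨ cong (_+ excess n (fromℕ n) j) (T-formula n j) ⟨
    Tˢ r n j + excess n (fromℕ n) j
      ≡⟨ cong (λ z → fromℕ z + excess n (fromℕ n) j) (T-below r r j<n) ⟩
    0ℚ + excess n (fromℕ n) j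
      ≡⟨ ℚ.+-identityˡ _ ⟩
    excess n (fromℕ n) j ∎)
  excess-full (suc b) n = *ˢ-cancelˡ F (F₀ 0<r) M {excess M (fromℕ n)} {P (fromℕ (suc n))} λ j j<M → begin
      (F *ˢ excess M (fromℕ n)) j
        ≡⟨ F*excess M (fromℕ n) j ⟩
      excess M (fromℕ n + 1ℚ) j
        ≡⟨ cong₂ (λ y z → excess y z j) (sym (ℕ.+-suc b n)) (sym (fromℕ-suc n)) ⟩
      excess (b ℕ.+ suc n) (fromℕ (suc n)) j
        ≡⟨ excess-full b (suc n) j (subst (j ℕ.<_) (sym (ℕ.+-suc b n)) j<M) ⟩
      P (fromℕ (suc (suc n))) j
        ≡⟨ cong (λ z → P z j) (fromℕ-suc (suc n)) ⟩
      P (fromℕ (suc n) + 1ℚ) j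
        ≡⟨ P-suc (fromℕ (suc n)) j ⟩
      (F *ˢ P (fromℕ (suc n))) j ∎
    where M = suc b ℕ.+ n

  -- Both sides agree after multiplication by p + 1, by the chain rule.
  θ-diagonal : ∀ p → (θ F *ˢ P (fromℕ p)) (suc p) ≡ P (fromℕ (suc p)) (suc p)
  θ-diagonal p = suc-cancelˡ p (sym (θ-power F (F₀ 0<r) p (suc p)))

  -- With m = q + 1, p the coefficient of t ^ m in F ^ (m + 1) and A that in
  -- F ^ m θ F, the chain rule gives (m + 1) A = m p.  Expanding F ^ m and
  -- F ^ (m + 1) by the excess congruence shows that A + C m = p, so
  -- (m + 1) C m = p.
  C-formula : ∀ q → C (suc q) ≡ (+ 1 / suc (suc q)) * P (fromℕ (suc (suc q))) (suc q)
  C-formula q = suc-cancelˡ m (begin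
    fromℕ (suc m) * C m
      ≡⟨ solve 3 (λ x c a → x :* c := x :* (a :+ c) :- x :* a) refl (fromℕ (suc m)) (C m) A ⟩
    fromℕ (suc m) * (A + C m) - fromℕ (suc m) * A
      ≡⟨ cong₂ (λ y z → fromℕ (suc m) * y - z) A+C (sym (θ-power F (F₀ 0<r) m m)) ⟩
    fromℕ (suc m) * p - fromℕ m * p
      ≡⟨ cong (λ z → z * p - fromℕ m * p) (fromℕ-suc m) ⟩
    (fromℕ m + 1ℚ) * p - fromℕ m * p
      ≡⟨ solve 2 (λ x y → (x :+ con 1ℚ) :* y :- x :* y := con 1ℚ :* y) refl (fromℕ m) p ⟩
    1ℚ * p
      ≡⟨ cong (_* p) (suc*recip m) ⟨
    fromℕ (suc m) * (+ 1 / suc m) * p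
      ≡⟨ ℚ.*-assoc (fromℕ (suc m)) (+ 1 / suc m) p ⟩
    fromℕ (suc m) * ((+ 1 / suc m) * p) ∎)
    where
    m = suc q
    p = P (fromℕ (suc m)) m
    A = (θ F *ˢ P (fromℕ m)) m
    partial = Σ[ k < m ] (C k * shift k (P (fromℕ m - fromℕ k)) m)

    -- With j = m - k, the coefficients of t ^ j in F ^ (j - 1) θ F and in F ^ j.
    term : ∀ k → k ℕ.< m → shift k (θ F *ˢ P (fromℕ q - fromℕ k)) m ≡ shift k (P (fromℕ m - fromℕ k)) m
    term k k<m@(s≤s k≤q) = begin
      shift k (θ F *ˢ P (fromℕ q - fromℕ k)) m
        ≡⟨ shift-above k (θ F *ˢ P (fromℕ q - fromℕ k)) (ℕ.<⇒≤ k<m) ⟩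
      (θ F *ˢ P (fromℕ q - fromℕ k)) (m ∸ k)
        ≡⟨ cong₂ (λ y z → (θ F *ˢ P y) z) (sym (fromℕ-∸ k≤q)) m∸k ⟩
      (θ F *ˢ P (fromℕ (q ∸ k))) (suc (q ∸ k))
        ≡⟨ θ-diagonal (q ∸ k) ⟩
      P (fromℕ (suc (q ∸ k))) (suc (q ∸ k))
        ≡⟨ cong₂ (λ y z → P y z) (trans (cong fromℕ (sym m∸k)) (fromℕ-∸ (ℕ.<⇒≤ k<m))) (sym m∸k) ⟩
      P (fromℕ m - fromℕ k) (m ∸ k)
        ≡⟨ shift-above k (P (fromℕ m - fromℕ k)) (ℕ.<⇒≤ k<m) ⟨
      shift k (P (fromℕ m - fromℕ k)) m ∎
      where
      m∸k : m ∸ k ≡ suc (q ∸ k)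
      m∸k = ℕ.+-∸-assoc 1 k≤q

    -- The term k = m drops out because θ F has no constant term.
    A≡partial : A ≡ partial
    A≡partial = begin
      (θ F *ˢ P (fromℕ m)) m
        ≡⟨ *ˢ-congʳ (θ F) m (λ j j≤m → excess-full 2 q j (s≤s j≤m)) ⟨
      (θ F *ˢ excess (suc m) (fromℕ q)) m
        ≡⟨ *ˢ-sumʳ (θ F) (suc m) C (λ k → shift k (P (fromℕ q - fromℕ k))) m ⟩
      Σ[ k < suc m ] (C k * (θ F *ˢ shift k (P (fromℕ q - fromℕ k))) m)
        ≡⟨ cong₂ _+_
             (sum-cong m (λ k k<m → cong (C k *_)
               (trans (*ˢ-shift (θ F) k (P (fromℕ q - fromℕ k)) m) (term k k<m))))
             (trans (cong (C m *_) (trans (*ˢ-shift (θ F) m (P (fromℕ q - fromℕ m)) m)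
               (trans (shift-diagonal m _) θ₀))) (ℚ.*-zeroʳ (C m))) ⟩
      partial + 0ℚ
        ≡⟨ ℚ.+-identityʳ partial ⟩
      partial ∎
      where
      θ₀ : (θ F *ˢ P (fromℕ q - fromℕ m)) 0 ≡ 0ℚ
      θ₀ = trans (ℚ.+-identityˡ _) (trans (cong (_* y) (ℚ.*-zeroˡ (F 0))) (ℚ.*-zeroˡ y))
        where y = P (fromℕ q - fromℕ m) 0

    A+C : A + C m ≡ p
    A+C = begin
      A + C m
        ≡⟨ cong₂ _+_ A≡partial (sym (ℚ.*-identityʳ (C m))) ⟩
      partial + C m * 1ℚ
        ≡⟨ cong (λ z → partial + C m * z) (trans (cong (λ z → P z 0) (sym (ℚ.+-inverseʳ (fromℕ m))))
             (sym (shift-diagonal m (P (fromℕ m - fromℕ m))))) ⟩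
      excess (suc m) (fromℕ m) m
        ≡⟨ excess-full 1 m m ℕ.≤-refl ⟩
      p ∎

  -- Expanding F ^ (n + 1) by the excess congruence with M = m + 1 cancels the
  -- terms k < n of T-formula.  The term k = n vanishes, and the others are
  -- indexed by i = m - k.
  T-offDiagonal : ∀ n d → Tˢ r n (suc d ℕ.+ n) ≡
    Σ[ i < suc d ] ((+ 1 / suc (suc d ℕ.+ n ∸ i))
      * P (fromℤ (+ i ℤ.- + (suc d ℕ.+ n) ℤ.+ + n)) i
      * P (fromℕ (suc (suc d ℕ.+ n ∸ i))) (suc d ℕ.+ n ∸ i))
  T-offDiagonal n d = begin
    Tˢ r n m
      ≡⟨ T-formula n m ⟩
    P (fromℕ (suc n)) m - sumBelow n g
      ≡⟨ cong (_- sumBelow n g) (excess-full (suc (suc d)) n m ℕ.≤-refl) ⟨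
    sumBelow (suc m) g - sumBelow n g
      ≡⟨ cong (_- sumBelow n g) (sum-split n (suc (suc d)) g) ⟩
    sumBelow n g + (Σ[ i < suc d ] g (m ∸ i) + g (m ∸ suc d)) - sumBelow n g
      ≡⟨ cong (λ z → sumBelow n g + (Σ[ i < suc d ] g (m ∸ i) + z) - sumBelow n g) g-n ⟩
    sumBelow n g + (Σ[ i < suc d ] g (m ∸ i) + 0ℚ) - sumBelow n g
      ≡⟨ solve 2 (λ x y → x :+ (y :+ con 0ℚ) :- x := y) refl (sumBelow n g) (Σ[ i < suc d ] g (m ∸ i)) ⟩
    Σ[ i < suc d ] g (m ∸ i)
      ≡⟨ sum-cong (suc d) term ⟩
    Σ[ i < suc d ] ((+ 1 / suc (m ∸ i)) * P (fromℤ (+ i ℤ.- + m ℤ.+ + n)) i * P (fromℕ (suc (m ∸ i))) (m ∸ i)) ∎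
    where
    m = suc d ℕ.+ n

    g : ℕ → ℚ
    g k = C k * shift k (P (fromℕ n - fromℕ k)) m

    -- F ^ 0 has no coefficient at t ^ (m - n), as n < m.
    g-n : g (m ∸ suc d) ≡ 0ℚ
    g-n = begin
      g (m ∸ suc d)
        ≡⟨ cong g (ℕ.m+n∸m≡n (suc d) n) ⟩
      C n * shift n (P (fromℕ n - fromℕ n)) m
        ≡⟨ cong (C n *_) (trans (shift-cong n (λ j → trans (cong (λ z → P z j) (ℚ.+-inverseʳ (fromℕ n))) (power-zero F j)) m)
             (shift-1ˢ-above (s≤s (ℕ.m≤n+m n d)))) ⟩
      C n * 0ℚ
        ≡⟨ ℚ.*-zeroʳ (C n) ⟩
      0ℚ ∎

    exponent : ∀ {i} → i ℕ.≤ m → fromℕ n - fromℕ (m ∸ i) ≡ fromℤ (+ i ℤ.- + m ℤ.+ + n)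
    exponent {i} i≤m = begin
      fromℕ n - fromℕ (m ∸ i)
        ≡⟨ cong (_-_ (fromℕ n)) (fromℕ-∸ i≤m) ⟩
      fromℕ n - (fromℕ m - fromℕ i)
        ≡⟨ solve 3 (λ n m i → n :- (m :- i) := (i :+ :- m) :+ n) refl (fromℕ n) (fromℕ m) (fromℕ i) ⟩
      fromℕ i + - fromℕ m + fromℕ n
        ≡⟨ cong (λ z → fromℕ i + z + fromℕ n) (fromℤ-neg (+ m)) ⟨
      fromℕ i + fromℤ (ℤ.- + m) + fromℕ n
        ≡⟨ cong (_+ fromℕ n) (fromℤ-+ (+ i) (ℤ.- + m)) ⟨
      fromℤ (+ i ℤ.- + m) + fromℕ n
        ≡⟨ fromℤ-+ (+ i ℤ.- + m) (+ n) ⟨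
      fromℤ (+ i ℤ.- + m ℤ.+ + n) ∎

    positive : ∀ {k} → 0 ℕ.< k → C k ≡ (+ 1 / suc k) * P (fromℕ (suc k)) k
    positive {suc q} _ = C-formula q

    term : ∀ i → i ℕ.< suc d → g (m ∸ i) ≡
      (+ 1 / suc (m ∸ i)) * P (fromℤ (+ i ℤ.- + m ℤ.+ + n)) i * P (fromℕ (suc (m ∸ i))) (m ∸ i)
    term i i<1+d = begin
      C k * shift k (P (fromℕ n - fromℕ k)) m
        ≡⟨ cong₂ _*_ (positive (ℕ.m<n⇒0<n∸m i<m))
             (trans (shift-above k (P (fromℕ n - fromℕ k)) (ℕ.m∸n≤m m i))
               (cong₂ (λ y z → P y z) (exponent (ℕ.<⇒≤ i<m)) (ℕ.m∸[m∸n]≡n (ℕ.<⇒≤ i<m)))) ⟩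
      (+ 1 / suc k) * y * z
        ≡⟨ solve 3 (λ x y z → x :* y :* z := x :* z :* y) refl (+ 1 / suc k) y z ⟩
      (+ 1 / suc k) * z * y ∎
      where
      k = m ∸ i
      y = P (fromℕ (suc k)) k
      z = P (fromℤ (+ i ℤ.- + m ℤ.+ + n)) i
      i<m : i ℕ.< m
      i<m = ℕ.<-≤-trans i<1+d (ℕ.m≤m+n (suc d) n)

  -- A ballot path that ends on the diagonal ends with an east step.
  T-diagonal : ∀ q → T r r (suc q) (suc q) ≡ T r r q (suc q)
  T-diagonal q = diagonal 0<r ℕ.≤-refl
    where
    diagonal : ∀ {u} → 0 ℕ.< u → u ℕ.≤ r → T r u (suc q) (suc q) ≡ T r r q (suc q)
    diagonal {suc u} _ u≤r = trans (T-interior u≤r ℕ.≤-refl)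
      (cong (ℕ._+ T r r q (suc q)) (T-below r u (ℕ.n<1+n q)))

-- Every summation index satisfies i < m ∸ n ≤ m, so m + 1 - i is suc (m ∸ i).
corollary9 : (r : ℕ) → 0 ℕ.< r →
  ((m n : ℕ) → n ℕ.< m →
    fromℕ (t n m r) ≡
      Σ[ i < m ∸ n ]
        ((+ 1 / suc (m ∸ i))
          * euler r (fromℤ (+ i ℤ.- + m ℤ.+ + n)) i
          * euler r (fromℕ (suc (m ∸ i))) (m ∸ i)))
  × ((n : ℕ) → 0 ℕ.< n →
    (t n n r ≡ t (n ∸ 1) n r)
    × (fromℕ (t (n ∸ 1) n r) ≡ (+ 1 / suc n) * euler r (fromℕ (suc n)) n))
corollary9 r 0<r = above , diagonal
  where
  summand : (m n i : ℕ) → ℚ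
  summand m n i = (+ 1 / suc (m ∸ i)) * euler r (fromℤ (+ i ℤ.- + m ℤ.+ + n)) i * euler r (fromℕ (suc (m ∸ i))) (m ∸ i)

  above : ∀ m n → n ℕ.< m → fromℕ (t n m r) ≡ sumBelow (m ∸ n) (summand m n)
  above m n n<m = trans (cong fromℕ (t≡T n m r))
    (subst₂ (λ k d → fromℕ (T r r n k) ≡ sumBelow d (summand k n))
      1+d+n≡m (sym m∸n≡1+d) (T-offDiagonal r 0<r n (ℕ.pred (m ∸ n))))
    where
    m∸n≡1+d : m ∸ n ≡ suc (ℕ.pred (m ∸ n))
    m∸n≡1+d = sym (ℕ.suc-pred (m ∸ n) {{ℕ.>-nonZero (ℕ.m<n⇒0<n∸m n<m)}})
    1+d+n≡m : suc (ℕ.pred (m ∸ n)) ℕ.+ n ≡ m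
    1+d+n≡m = trans (cong (ℕ._+ n) (sym m∸n≡1+d)) (ℕ.m∸n+n≡m (ℕ.<⇒≤ n<m))

  diagonal : ∀ n → 0 ℕ.< n → (t n n r ≡ t (n ∸ 1) n r)
    × (fromℕ (t (n ∸ 1) n r) ≡ (+ 1 / suc n) * euler r (fromℕ (suc n)) n)
  diagonal (suc q) _ = same
    , trans (cong fromℕ (trans (sym same) (t≡T (suc q) (suc q) r))) (C-formula r 0<r q)
    where
    same : t (suc q) (suc q) r ≡ t q (suc q) r
    same = trans (t≡T (suc q) (suc q) r) (trans (T-diagonal r 0<r q) (sym (t≡T q (suc q) r)))
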